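{- Let $\mathcal{L}_{\rm F}$ be the Fibonacci language and let ${\rm S}:\mathcal{L}_{\rm F}\to\mathbb{N}$ be a homomorphism. Let $\mathcal{E}=\{(1,1),(1,2),(1,3),(2,1)\}$. If $({\rm S}(0),{\rm S}(1))\in\mathcal{E}$ then $\mathbb{N}\setminus{\rm S}(\mathcal{L}_{\rm F})$ is empty; otherwise $\mathbb{N}\setminus{\rm S}(\mathcal{L}_{\rm F})$ is infinite.
   Context: $\mathbb{N}=\{1,2,3,\dots\}$ and $[x]$ denotes the integer part (floor) of $x$. Let $\Phi=(1+\sqrt5)/2$ and $\alpha=2-\Phi$. The characteristic word $c_\alpha=(c_\alpha(n))_{n\ge0}$ is the infinite word over $\{0,1\}$ with $c_\alpha(n)=[(n+2)\alpha]-[(n+1)\alpha]$ (the infinite Fibonacci word). The Fibonacci language $\mathcal{L}_{\rm F}$ is the set of all nonempty finite words occurring as factors of $c_\alpha$. A homomorphism ${\rm S}:\mathcal{L}_{\rm F}\to\mathbb{N}$ is a map with ${\rm S}(w_1\cdots w_n)={\rm S}(w_1)+\cdots+{\rm S}(w_n)$, determined by ${\rm S}(0),{\rm S}(1)\in\mathbb{N}$. -}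

module Defs where

open import Data.Fin.Base using (Fin; zero; suc; toℕ)
open import Data.Integer.Base as ℤ using (ℤ; +_; -[1+_]; 0ℤ; 1ℤ; ∣_∣)
open import Data.Integer.Properties as ℤ using ()
open import Data.Integer.Tactic.RingSolver using (solve-∀)
open import Data.List.Base using (List; []; _∷_; [_]; map; length; applyUpTo)
open import Data.Nat.Base as ℕ using (ℕ; zero; suc; s≤s; z≤n)
open import Data.Nat.ListAction using (sum)
open import Data.Nat.Properties as ℕ using ()
open import Data.Product.Base using (Σ; ∃; _×_; _,_; proj₁)
open import Function.Definitions using (Injective)
open import Relation.Binary.PropositionalEquality using (_≡_; _≢_; refl; sym; trans; cong; cong₂; subst; subst₂)
open import Relation.Nullary using (¬_; Dec; yes; no)
open import Relation.Unary using (Pred; _∈_)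
open import Level using (0ℓ)

-- ⟨ p ⊹ q √5⟩/2 is the real number (p + q√5)/2.
record Quad : Set where
  constructor ⟨_⊹_√5⟩/2
  field
    rat irr : ℤ

fromℤ : ℤ → Quad
fromℤ k = ⟨ + 2 ℤ.* k ⊹ 0ℤ √5⟩/2

infixl 6 _-_
infixl 7 _·_
infix 4 _≤_ _<_ _≤?_

_-_ : Quad → Quad → Quad
⟨ p ⊹ q √5⟩/2 - ⟨ r ⊹ s √5⟩/2 = ⟨ p ℤ.- r ⊹ q ℤ.- s √5⟩/2

_·_ : ℕ → Quad → Quad
n · ⟨ p ⊹ q √5⟩/2 = ⟨ + n ℤ.* p ⊹ + n ℤ.* q √5⟩/2

signedSquare : ℤ → ℤ
signedSquare z = z ℤ.* + ∣ z ∣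

-- t ↦ t∣t∣ is odd and strictly increasing on ℝ, so the sign of p + q√5, i.e. the
-- comparison of p with -q√5, is the sign of the integer p∣p∣ + 5q∣q∣.
signForm : Quad → ℤ
signForm ⟨ p ⊹ q √5⟩/2 = signedSquare p ℤ.+ + 5 ℤ.* signedSquare q

_≤_ : Quad → Quad → Set
x ≤ y = 0ℤ ℤ.≤ signForm (y - x)

_<_ : Quad → Quad → Set
x < y = 0ℤ ℤ.< signForm (y - x)

_≤?_ : ∀ x y → Dec (x ≤ y)
x ≤? y = 0ℤ ℤ.≤? signForm (y - x)

-- The first of k, k - 1, …, k - fuel that is ≤ x.
searchDown : Quad → ℤ → ℕ → ℤ
searchDown x k zero = k
searchDown x k (suc fuel) with fromℤ k ≤? x
... | yes _ = k
... | no _ = searchDown x (ℤ.pred k) fuel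

-- An integer bound for ∣ (p + q√5)/2 ∣.
bound : Quad → ℕ
bound ⟨ p ⊹ q √5⟩/2 = ∣ p ∣ ℕ.+ 3 ℕ.* ∣ q ∣

⌊_⌋ : Quad → ℤ
⌊ x ⌋ = searchDown x (+ bound x) (bound x ℕ.+ bound x)

private
  signedSquare-neg : ∀ z → signedSquare (ℤ.- z) ≡ ℤ.- signedSquare z
  signedSquare-neg z =
    trans (cong (λ m → ℤ.- z ℤ.* + m) (ℤ.∣-i∣≡∣i∣ z)) (sym (ℤ.neg-distribˡ-* z (+ ∣ z ∣)))

  signForm-flip : ∀ x y → signForm (y - x) ≡ ℤ.- signForm (x - y)
  signForm-flip ⟨ p ⊹ q √5⟩/2 ⟨ r ⊹ s √5⟩/2 =
    trans (cong₂ (λ a b → a ℤ.+ + 5 ℤ.* b) (flip p r) (flip q s))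
          (neg-lin (signedSquare (p ℤ.- r)) (signedSquare (q ℤ.- s)))
    where
    swap : ∀ a b → b ℤ.- a ≡ ℤ.- (a ℤ.- b)
    swap = solve-∀
    flip : ∀ a b → signedSquare (b ℤ.- a) ≡ ℤ.- signedSquare (a ℤ.- b)
    flip a b = trans (cong signedSquare (swap a b)) (signedSquare-neg (a ℤ.- b))
    neg-lin : ∀ a b → ℤ.- a ℤ.+ + 5 ℤ.* (ℤ.- b) ≡ ℤ.- (a ℤ.+ + 5 ℤ.* b)
    neg-lin = solve-∀

  ≰⇒> : ∀ {x y} → ¬ x ≤ y → y < x
  ≰⇒> {x} {y} x≰y =
    subst (0ℤ ℤ.<_) (sym (signForm-flip y x)) (ℤ.neg-mono-< (ℤ.≰⇒> x≰y))

  5nn≤3n3n : ∀ n → 5 ℕ.* (n ℕ.* n) ℕ.≤ (3 ℕ.* n) ℕ.* (3 ℕ.* n)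
  5nn≤3n3n n = subst (5 ℕ.* (n ℕ.* n) ℕ.≤_) (sym eq) (ℕ.*-monoˡ-≤ (n ℕ.* n) {5} {9} (s≤s (s≤s (s≤s (s≤s (s≤s z≤n))))))
    where
    open import Data.Nat.Solver using (module +-*-Solver)
    open +-*-Solver
    eq : (3 ℕ.* n) ℕ.* (3 ℕ.* n) ≡ 9 ℕ.* (n ℕ.* n)
    eq = solve 1 (λ n → (con 3 :* n) :* (con 3 :* n) := con 9 :* (n :* n)) refl n

  -nn≤signedSquare : ∀ q → ℤ.- (+ (∣ q ∣ ℕ.* ∣ q ∣)) ℤ.≤ signedSquare q
  -nn≤signedSquare (+ n) = subst (ℤ.- (+ (n ℕ.* n)) ℤ.≤_) (ℤ.pos-* n n) ℤ.neg-≤-pos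
  -nn≤signedSquare -[1+ n ] = ℤ.≤-refl

  signForm-lower : ∀ m q → + (m ℕ.* m) ℤ.- + (5 ℕ.* (∣ q ∣ ℕ.* ∣ q ∣)) ℤ.≤ signForm ⟨ + m ⊹ q √5⟩/2
  signForm-lower m q = ℤ.+-mono-≤ (ℤ.≤-reflexive (ℤ.pos-* m m))
    (ℤ.≤-trans (ℤ.≤-reflexive (trans (cong ℤ.-_ (ℤ.pos-* 5 (∣ q ∣ ℕ.* ∣ q ∣))) (ℤ.neg-distribʳ-* (+ 5) _)))
               (ℤ.*-monoˡ-≤-nonNeg (+ 5) (-nn≤signedSquare q)))

  signForm-nonNeg : ∀ r q → + (3 ℕ.* ∣ q ∣) ℤ.≤ r → 0ℤ ℤ.≤ signForm ⟨ r ⊹ q √5⟩/2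
  signForm-nonNeg (+ m) q (ℤ.+≤+ h) =
    ℤ.≤-trans (ℤ.i≤j⇒0≤j-i (ℤ.+≤+ (ℕ.≤-trans (5nn≤3n3n ∣ q ∣) (ℕ.*-mono-≤ h h)))) (signForm-lower m q)

  signForm-pos : ∀ r q → + (3 ℕ.* ∣ q ∣) ℤ.< r → 0ℤ ℤ.< signForm ⟨ r ⊹ q √5⟩/2
  signForm-pos (+ m) q (ℤ.+<+ h) =
    ℤ.<-≤-trans
      (subst (ℤ._< + (m ℕ.* m) ℤ.- + n) (ℤ.+-inverseʳ (+ n))
        (ℤ.+-monoˡ-< (ℤ.- + n) (ℤ.+<+ (ℕ.≤-<-trans (5nn≤3n3n ∣ q ∣) (ℕ.*-mono-< h h)))))
      (signForm-lower m q)
    where n = 5 ℕ.* (∣ q ∣ ℕ.* ∣ q ∣)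

  i≤∣i∣ : ∀ i → i ℤ.≤ + ∣ i ∣
  i≤∣i∣ (+ n) = ℤ.≤-refl
  i≤∣i∣ -[1+ n ] = ℤ.-≤+

  split-bound : ∀ p q → + 2 ℤ.* + bound ⟨ p ⊹ q √5⟩/2 ≡ + ∣ p ∣ ℤ.+ (+ (3 ℕ.* ∣ q ∣) ℤ.+ + bound ⟨ p ⊹ q √5⟩/2)
  split-bound p q = lem (+ ∣ p ∣) (+ (3 ℕ.* ∣ q ∣))
    where
    lem : ∀ a b → + 2 ℤ.* (a ℤ.+ b) ≡ a ℤ.+ (b ℤ.+ (a ℤ.+ b))
    lem = solve-∀

  room : ∀ p q r → ∣ r ∣ ≡ ∣ p ∣ → + (3 ℕ.* ∣ q ∣) ℤ.≤ + 2 ℤ.* + bound ⟨ p ⊹ q √5⟩/2 ℤ.+ r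
  room p q r eq = subst (+ (3 ℕ.* ∣ q ∣) ℤ.≤_) (trans (lem (+ ∣ p ∣) t b r) (cong (ℤ._+ r) (sym (split-bound p q))))
      (ℤ.≤-trans (ℤ.i≤i+j t (+ bound x)) (subst (ℤ._≤ (+ ∣ p ∣ ℤ.+ r) ℤ.+ (t ℤ.+ b)) (ℤ.+-identityˡ _) (ℤ.+-monoˡ-≤ (t ℤ.+ b) 0≤)))
    where
    x = ⟨ p ⊹ q √5⟩/2
    t = + (3 ℕ.* ∣ q ∣)
    b = + bound x
    lem : ∀ a t b r → (a ℤ.+ r) ℤ.+ (t ℤ.+ b) ≡ (a ℤ.+ (t ℤ.+ b)) ℤ.+ r
    lem = solve-∀
    0≤ : 0ℤ ℤ.≤ + ∣ p ∣ ℤ.+ r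
    0≤ = subst (λ a → 0ℤ ℤ.≤ + ∣ p ∣ ℤ.+ a) (ℤ.neg-involutive r)
           (ℤ.i≤j⇒0≤j-i (subst (λ a → ℤ.- r ℤ.≤ + a) (trans (ℤ.∣-i∣≡∣i∣ r) eq) (i≤∣i∣ (ℤ.- r))))

  bound-lower : ∀ x → fromℤ (ℤ.- + bound x) ≤ x
  bound-lower x@(⟨ p ⊹ q √5⟩/2) = signForm-nonNeg _ (q ℤ.- 0ℤ)
    (subst₂ ℤ._≤_ (cong (λ z → + (3 ℕ.* ∣ z ∣)) (sym (ℤ.+-identityʳ q))) (lem (+ bound x) p) (room p q p refl))
    where
    lem : ∀ b p → + 2 ℤ.* b ℤ.+ p ≡ p ℤ.- + 2 ℤ.* (ℤ.- b)
    lem = solve-∀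

  bound-upper : ∀ x → x < fromℤ (ℤ.suc (+ bound x))
  bound-upper x@(⟨ p ⊹ q √5⟩/2) = signForm-pos _ (0ℤ ℤ.- q)
    (subst₂ ℤ._<_ (cong (λ n → + (3 ℕ.* n)) (sym (trans (cong ∣_∣ (ℤ.+-identityˡ (ℤ.- q))) (ℤ.∣-i∣≡∣i∣ q))))
      (lem (+ bound x) p)
      (ℤ.≤-<-trans (room p q (ℤ.- p) (ℤ.∣-i∣≡∣i∣ p))
        (subst (ℤ._< + 2 ℤ.+ (+ 2 ℤ.* + bound x ℤ.+ ℤ.- p)) (ℤ.+-identityˡ _)
          (ℤ.+-monoˡ-< (+ 2 ℤ.* + bound x ℤ.+ ℤ.- p) {0ℤ} {+ 2} (ℤ.+<+ (s≤s z≤n))))))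
    where
    lem : ∀ b p → + 2 ℤ.+ (+ 2 ℤ.* b ℤ.+ ℤ.- p) ≡ + 2 ℤ.* (1ℤ ℤ.+ b) ℤ.- p
    lem = solve-∀

  searchDown-spec : ∀ x k fuel → fromℤ (k ℤ.- + fuel) ≤ x → x < fromℤ (ℤ.suc k) →
                    fromℤ (searchDown x k fuel) ≤ x × x < fromℤ (ℤ.suc (searchDown x k fuel))
  searchDown-spec x k zero lo hi = subst (λ z → fromℤ z ≤ x) (ℤ.+-identityʳ k) lo , hi
  searchDown-spec x k (suc fuel) lo hi with fromℤ k ≤? x
  ... | yes k≤x = k≤x , hi
  ... | no k≰x = searchDown-spec x (ℤ.pred k) fuel
        (subst (λ z → fromℤ z ≤ x) (lem k (+ fuel)) lo)
        (subst (λ z → x < fromℤ z) (sym (ℤ.suc-pred k)) (≰⇒> {fromℤ k} {x} k≰x))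
    where
    lem : ∀ k f → k ℤ.- (1ℤ ℤ.+ f) ≡ (ℤ.- 1ℤ ℤ.+ k) ℤ.- f
    lem = solve-∀

⌊⌋-spec : ∀ x → fromℤ ⌊ x ⌋ ≤ x × x < fromℤ (ℤ.suc ⌊ x ⌋)
⌊⌋-spec x = searchDown-spec x (+ bound x) (bound x ℕ.+ bound x)
  (subst (λ z → fromℤ z ≤ x) (lem (+ bound x)) (bound-lower x)) (bound-upper x)
  where
  lem : ∀ b → ℤ.- b ≡ b ℤ.- (b ℤ.+ b)
  lem = solve-∀

Φ : Quad
Φ = ⟨ 1ℤ ⊹ 1ℤ √5⟩/2

α : Quad
α = fromℤ (+ 2) - Φ

cα : ℕ → ℤ
cα n = ⌊ (n ℕ.+ 2) · α ⌋ ℤ.- ⌊ (n ℕ.+ 1) · α ⌋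

Letter : Set
Letter = Fin 2

Word : Set
Word = List Letter

OccursAt : ℕ → Word → Set
OccursAt i w = map (λ a → + toℕ a) w ≡ applyUpTo (λ j → cα (i ℕ.+ j)) (length w)

FibonacciLanguage : Pred Word 0ℓ
FibonacciLanguage w = w ≢ [] × ∃ λ i → OccursAt i w

𝓛F : Set
𝓛F = Σ Word FibonacciLanguage

letter : Letter → 𝓛F
letter zero = [ zero ] , (λ ()) , 0 , refl
letter (suc zero) = [ suc zero ] , (λ ()) , 1 , refl

-- Elements of 𝓛F carry a chosen occurrence; isHom forces S to depend on the word only.
record Homomorphism : Set where
  field
    S : 𝓛F → ℕ
    positive : ∀ u → 1 ℕ.≤ S u
    isHom : ∀ u → S u ≡ sum (map (λ a → S (letter a)) (proj₁ u))

ℕ⁺ : Pred ℕ 0ℓ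
ℕ⁺ n = 1 ℕ.≤ n

Image : (𝓛F → ℕ) → Pred ℕ 0ℓ
Image S n = ∃ λ u → S u ≡ n

Infinite : Pred ℕ 0ℓ → Set
Infinite P = Σ (ℕ → ℕ) λ f → Injective _≡_ _≡_ f × (∀ k → f k ∈ P)

𝓔 : List (ℕ × ℕ)
𝓔 = (1 , 1) ∷ (1 , 2) ∷ (1 , 3) ∷ (2 , 1) ∷ []

{-# OPTIONS --safe #-}
-- Write z n = ⌊nα⌋.  Then z (m + n) - z m - z n is 0 or 1, so a factor of length n
-- of the Fibonacci word contains z n or z n + 1 letters 1, and only two weights
-- occur at each length.  Factors of length 21 contain 8 or 9 letters 1; outside 𝓔
-- and apart from (2,2) such a block weighs at least 45 > 2 · 21, so the weights have
-- density less than one and by the pigeonhole principle the gaps never stop.  For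
-- (2,2) all weights are even.  For pairs in 𝓔 the prefix weights leave only small
-- gaps, and these are filled by prefixes with their first one, two or four letters
-- removed.
module Submission where

open import Defs
open import Data.Empty using (⊥-elim)
open import Data.Fin.Base using (zero; suc; toℕ)
open import Data.Fin.Properties using (any?; pigeonhole; toℕ-injective; toℕ<n)
open import Data.Integer.Base as ℤ using (ℤ; +_; -[1+_]; 0ℤ; 1ℤ)
import Data.Integer.Properties as ℤ
import Data.Integer.Tactic.RingSolver as ℤ-Solver
open import Data.List.Base using (List; []; _∷_; _++_; map; length; lookup; applyUpTo)
open import Data.List.Membership.DecPropositional using (_∈?_)
open import Data.List.Membership.Propositional using (_∈_; _∉_)
open import Data.List.Membership.Propositional.Properties using (∈-applyUpTo⁺; ∈-++⁺ˡ; ∈-++⁺ʳ)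
open import Data.List.Properties using (length-++; length-applyUpTo; map-cong; ∷-injective)
open import Data.List.Relation.Unary.Any using (here; there; index)
open import Data.List.Relation.Unary.Any.Properties using (lookup-index)
open import Data.Nat.Base as ℕ using (ℕ; zero; suc; _+_; _*_; _∸_; s≤s; z≤n; s≤s⁻¹)
open import Data.Nat.ListAction using (sum)
import Data.Nat.Properties as ℕ
open import Data.Nat.Tactic.RingSolver using (solve-∀)
open import Data.Product.Base using (∃; _×_; _,_; proj₁; proj₂)
open import Data.Sum.Base as Sum using (_⊎_; inj₁; inj₂; [_,_]′)
open import Function.Base using (_∘_)
open import Function.Definitions using (Injective)
open import Level using (0ℓ)
open import Relation.Binary.Definitions using (tri<; tri≈; tri>)
open import Relation.Binary.PropositionalEquality
open import Relation.Nullary using (¬_; yes; no; contradiction)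
open import Relation.Nullary.Decidable using (¬?; decidable-stable)
open import Relation.Unary using (Pred; Empty; _∖_)

-- Comparison with √5

square-cancel-< : ∀ {x y} → x * x ℕ.< y * y → x ℕ.< y
square-cancel-< lt = ℕ.≰⇒> λ y≤x → ℕ.<⇒≱ lt (ℕ.*-mono-≤ y≤x y≤x)

private
  *-interchange : ∀ p r → p * p * (r * r) ≡ p * r * (p * r)
  *-interchange = solve-∀

  5*-interchange : ∀ m n → 5 * (m * m) * (5 * (n * n)) ≡ 5 * (m * n) * (5 * (m * n))
  5*-interchange = solve-∀

  square-expand : ∀ p r → p * p + r * r + 2 * (p * r) ≡ (p + r) * (p + r)
  square-expand = solve-∀

  5*-square-expand : ∀ m n → 5 * (m * m) + 5 * (n * n) + 2 * (5 * (m * n)) ≡ 5 * ((m + n) * (m + n))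
  5*-square-expand = solve-∀

-- This multiplies m√5 ≤ p by n√5 ≤ r without square roots: the product of the hypotheses compares
-- the squares of both sides.
product-≤ : ∀ {m n p r} → 5 * (m * m) ℕ.≤ p * p → 5 * (n * n) ℕ.≤ r * r → 5 * (m * n) ℕ.≤ p * r
product-≤ {m} {n} {p} {r} hp hr = ℕ.≮⇒≥ λ lt →
  ℕ.<⇒≱ (ℕ.*-mono-< lt lt)
    (subst₂ ℕ._≤_ (5*-interchange m n) (*-interchange p r) (ℕ.*-mono-≤ hp hr))

product-< : ∀ {m n p r} → p * p ℕ.< 5 * (m * m) → r * r ℕ.< 5 * (n * n) → p * r ℕ.< 5 * (m * n)
product-< {m} {n} {p} {r} hp hr = ℕ.≰⇒> λ le →
  ℕ.<⇒≱ (subst₂ ℕ._<_ (*-interchange p r) (5*-interchange m n) (ℕ.*-mono-< hp hr))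
    (ℕ.*-mono-≤ le le)

-- The squared form of adding m√5 ≤ p and n√5 ≤ r; `product-≤` supplies the cross term.
square-+-≤ : ∀ {m n p r} → 5 * (m * m) ℕ.≤ p * p → 5 * (n * n) ℕ.≤ r * r →
             5 * ((m + n) * (m + n)) ℕ.≤ (p + r) * (p + r)
square-+-≤ {m} {n} {p} {r} hp hr = subst₂ ℕ._≤_ (5*-square-expand m n) (square-expand p r)
  (ℕ.+-mono-≤ (ℕ.+-mono-≤ hp hr) (ℕ.*-monoʳ-≤ 2 (product-≤ {m} {n} {p} {r} hp hr)))

square-+-< : ∀ {m n p r} → p * p ℕ.< 5 * (m * m) → r * r ℕ.< 5 * (n * n) →
             (p + r) * (p + r) ℕ.< 5 * ((m + n) * (m + n))
square-+-< {m} {n} {p} {r} hp hr = subst₂ ℕ._<_ (square-expand p r) (5*-square-expand m n)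
  (ℕ.+-mono-< (ℕ.+-mono-< hp hr) (ℕ.*-monoʳ-< 2 (product-< {m} {n} {p} {r} hp hr)))

-- Integer parts of multiples of α

signedSquare-pos : ∀ n → signedSquare (+ n) ≡ + (n * n)
signedSquare-pos n = sym (ℤ.pos-* n n)

signedSquare-neg : ∀ n → signedSquare (ℤ.- + n) ≡ ℤ.- + (n * n)
signedSquare-neg zero    = refl
signedSquare-neg (suc n) = refl

z : ℕ → ℤ
z n = ⌊ n · α ⌋

-- With n√5 = 3n - 2nα, the two inequalities say 2 + p ≥ n√5 > p.
⌊nα⌋-spec : ∀ n → 1 ℕ.≤ n → ∃ λ p → + 3 ℤ.* + n ℤ.- + 2 ℤ.* z n ≡ + (2 + p) ×
            5 * (n * n) ℕ.≤ (2 + p) * (2 + p) × p * p ℕ.< 5 * (n * n)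
⌊nα⌋-spec n 1≤n = build _ refl lower upper
  where
  P = + 3 ℤ.* + n ℤ.- + 2 ℤ.* z n
  N = + (5 * (n * n))

  lower : 0ℤ ℤ.≤ signedSquare P ℤ.- N
  lower = subst (0ℤ ℤ.≤_) (cong₂ ℤ._+_ (cong signedSquare (eqP (+ n) (z n)))
      (trans (cong (λ q → + 5 ℤ.* q) (trans (cong signedSquare (eqn (+ n))) (signedSquare-neg n)))
        (trans (sym (ℤ.neg-distribʳ-* (+ 5) (+ (n * n)))) (cong ℤ.-_ (sym (ℤ.pos-* 5 (n * n)))))))
      (proj₁ (⌊⌋-spec (n · α)))
    where
    eqP : ∀ n z → n ℤ.* + 3 ℤ.- + 2 ℤ.* z ≡ + 3 ℤ.* n ℤ.- + 2 ℤ.* z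
    eqP = ℤ-Solver.solve-∀
    eqn : ∀ n → n ℤ.* -[1+ 0 ] ℤ.- 0ℤ ≡ ℤ.- n
    eqn = ℤ-Solver.solve-∀

  upper : 0ℤ ℤ.< signedSquare (+ 2 ℤ.- P) ℤ.+ N
  upper = subst (0ℤ ℤ.<_) (cong₂ ℤ._+_ (cong signedSquare (eqP (+ n) (z n)))
      (trans (cong (λ q → + 5 ℤ.* q) (trans (cong signedSquare (eqn (+ n))) (signedSquare-pos n)))
        (sym (ℤ.pos-* 5 (n * n)))))
      (proj₂ (⌊⌋-spec (n · α)))
    where
    eqP : ∀ n z → + 2 ℤ.* (1ℤ ℤ.+ z) ℤ.- n ℤ.* + 3 ≡ + 2 ℤ.- (+ 3 ℤ.* n ℤ.- + 2 ℤ.* z)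
    eqP = ℤ-Solver.solve-∀
    eqn : ∀ n → 0ℤ ℤ.- n ℤ.* -[1+ 0 ] ≡ n
    eqn = ℤ-Solver.solve-∀

  5≤ : 5 ℕ.≤ 5 * (n * n)
  5≤ = ℕ.*-monoʳ-≤ 5 (ℕ.*-mono-≤ 1≤n 1≤n)

  drop-N : ∀ P → 0ℤ ℤ.≤ signedSquare P ℤ.- N → N ℤ.≤ signedSquare P
  drop-N P = ℤ.0≤i-j⇒j≤i

  build : ∀ P → + 3 ℤ.* + n ℤ.- + 2 ℤ.* z n ≡ P →
          0ℤ ℤ.≤ signedSquare P ℤ.- N → 0ℤ ℤ.< signedSquare (+ 2 ℤ.- P) ℤ.+ N →
          ∃ λ p → + 3 ℤ.* + n ℤ.- + 2 ℤ.* z n ≡ + (2 + p) ×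
            5 * (n * n) ℕ.≤ (2 + p) * (2 + p) × p * p ℕ.< 5 * (n * n)
  -- Values of P below 2 are excluded: their signed square is at most 1, whereas `N` is at least 5.
  build -[1+ k ] eq lo hi with drop-N -[1+ k ] lo
  ... | ()
  build (+ 0) eq lo hi with ℕ.≤-trans 5≤ (ℤ.drop‿+≤+ (drop-N (+ 0) lo))
  ... | ()
  build (+ 1) eq lo hi with ℕ.≤-trans 5≤ (ℤ.drop‿+≤+ (drop-N (+ 1) lo))
  ... | s≤s ()
  build (+ suc (suc p)) eq lo hi = p , eq ,
    ℤ.drop‿+≤+ (subst (N ℤ.≤_) (signedSquare-pos (2 + p)) (drop-N (+ (2 + p)) lo)) ,
    ℤ.drop‿+<+ (subst₂ ℤ._<_ (ℤ.+-identityʳ (+ (p * p))) (eqs (+ (p * p)) N) (ℤ.+-monoʳ-< (+ (p * p)) hi′))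
    where
    eq2 : ∀ p → + 2 ℤ.- (+ 2 ℤ.+ p) ≡ ℤ.- p
    eq2 = ℤ-Solver.solve-∀
    eqs : ∀ a b → a ℤ.+ (ℤ.- a ℤ.+ b) ≡ b
    eqs = ℤ-Solver.solve-∀
    hi′ : 0ℤ ℤ.< ℤ.- + (p * p) ℤ.+ N
    hi′ = subst (λ x → 0ℤ ℤ.< x ℤ.+ N)
            (trans (cong signedSquare (eq2 (+ p))) (signedSquare-neg p)) hi

IsBit : ℤ → Set
IsBit d = d ≡ 0ℤ ⊎ d ≡ 1ℤ

-- Since 2d = 2 + p - s, the two bounds say -2 < 2d < 4.
double-bounded : ∀ d p s → + 2 ℤ.* d ℤ.+ + s ≡ + (2 + p) → s ℕ.< 4 + p → p ℕ.< 2 + s → IsBit d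
double-bounded (+ 0) p s eq s< p< = inj₁ refl
double-bounded (+ 1) p s eq s< p< = inj₂ refl
double-bounded (+ suc (suc k)) p s eq s< p< =
  ⊥-elim (ℕ.<⇒≱ p< (subst (2 + s ℕ.≤_) p≡ (ℕ.m≤m+n (2 + s) (k + k))))
  where
  rearrange : ∀ k s → + 2 ℤ.* (+ 2 ℤ.+ k) ℤ.+ s ≡ + 2 ℤ.+ (+ 2 ℤ.+ s ℤ.+ (k ℤ.+ k))
  rearrange = ℤ-Solver.solve-∀
  p≡ : 2 + s + (k + k) ≡ p
  p≡ = ℕ.+-cancelˡ-≡ 2 _ _ (ℤ.+-injective (trans (sym (rearrange (+ k) (+ s))) eq))
double-bounded -[1+ k ] p s eq s< p< =
  ⊥-elim (ℕ.<⇒≱ s< (subst (4 + p ℕ.≤_) (sym s≡) (ℕ.m≤m+n (4 + p) (k + k))))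
  where
  rearrange : ∀ k s → s ≡ + 2 ℤ.* (ℤ.- (1ℤ ℤ.+ k)) ℤ.+ s ℤ.+ (+ 2 ℤ.+ (k ℤ.+ k))
  rearrange = ℤ-Solver.solve-∀
  s≡ : s ≡ 4 + p + (k + k)
  s≡ = trans (ℤ.+-injective (trans (rearrange (+ k) (+ s)) (cong (ℤ._+ (+ 2 ℤ.+ (+ k ℤ.+ + k))) eq)))
             (shift p k)
    where
    shift : ∀ p k → 2 + p + (2 + (k + k)) ≡ 4 + p + (k + k)
    shift = solve-∀

-- Adding the bounds for m and n gives p + r < (m + n)√5 ≤ 4 + p + r, while s < (m + n)√5 ≤ 2 + s.
-- Comparing them yields the bounds that `double-bounded` requires.
z-+ : ∀ m n → 1 ℕ.≤ m → 1 ℕ.≤ n → IsBit (z (m + n) ℤ.- z m ℤ.- z n)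
z-+ m n 1≤m 1≤n
  with p , eqp , lop , hip ← ⌊nα⌋-spec m 1≤m
  with r , eqr , lor , hir ← ⌊nα⌋-spec n 1≤n
  with s , eqs , los , his ← ⌊nα⌋-spec (m + n) (ℕ.≤-trans 1≤m (ℕ.m≤m+n m n))
  = double-bounded _ (p + r) s eq
      (subst (s ℕ.<_) (shift p r)
        (square-cancel-< (ℕ.<-≤-trans his (square-+-≤ {m} {n} {2 + p} {2 + r} lop lor))))
      (square-cancel-< (ℕ.<-≤-trans (square-+-< {m} {n} {p} {r} hip hir) los))
  where
  shift : ∀ p r → 2 + p + (2 + r) ≡ 4 + (p + r)
  shift = solve-∀
  regroup : ∀ m n a b c s → + 2 ℤ.* (c ℤ.- a ℤ.- b) ℤ.+ s ≡
            (+ 3 ℤ.* m ℤ.- + 2 ℤ.* a) ℤ.+ (+ 3 ℤ.* n ℤ.- + 2 ℤ.* b)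
              ℤ.- (+ 3 ℤ.* (m ℤ.+ n) ℤ.- + 2 ℤ.* c) ℤ.+ s
  regroup = ℤ-Solver.solve-∀
  cancel : ∀ p r s → (+ 2 ℤ.+ p) ℤ.+ (+ 2 ℤ.+ r) ℤ.- (+ 2 ℤ.+ s) ℤ.+ s ≡ + 2 ℤ.+ (p ℤ.+ r)
  cancel = ℤ-Solver.solve-∀
  eq : + 2 ℤ.* (z (m + n) ℤ.- z m ℤ.- z n) ℤ.+ + s ≡ + (2 + (p + r))
  eq = trans (regroup (+ m) (+ n) (z m) (z n) (z (m + n)) (+ s))
         (trans (cong₂ (λ x y → x ℤ.- y ℤ.+ + s) (cong₂ ℤ._+_ eqp eqr) eqs)
           (cancel (+ p) (+ r) (+ s)))

-- The letters of the Fibonacci word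

-- Total on ℤ with the letter 1 as default; `toℕ-ℓ` shows that only 0 and 1 occur as arguments in
-- `ℓ`.
letterOf : ℤ → Letter
letterOf (+ zero) = zero
letterOf _        = suc zero

ℓ : ℕ → Letter
ℓ n = letterOf (cα n)

toℕ-letterOf : ∀ {d} → IsBit d → + toℕ (letterOf d) ≡ d
toℕ-letterOf (inj₁ refl) = refl
toℕ-letterOf (inj₂ refl) = refl

-- As `z 1` = 0, the difference `cα n` is the bit that `z-+` provides for n + 1 and 1.
toℕ-ℓ : ∀ n → + toℕ (ℓ n) ≡ cα n
toℕ-ℓ n = toℕ-letterOf {cα n} (subst IsBit eq (z-+ (n + 1) 1 (ℕ.m≤n+m 1 n) (s≤s z≤n)))
  where
  eq : z (n + 1 + 1) ℤ.- z (n + 1) ℤ.- z 1 ≡ cα n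
  eq = trans (ℤ.+-identityʳ _) (cong (λ k → z k ℤ.- z (n + 1)) (ℕ.+-assoc n 1 1))

prefixWeight : (Letter → ℕ) → ℕ → ℕ
prefixWeight wt zero    = 0
prefixWeight wt (suc n) = prefixWeight wt n + wt (ℓ n)

ones : ℕ → ℕ
ones = prefixWeight toℕ

-- The differences `cα` telescope from `z 1` = 0, whence the shift of the index.
ones≡z : ∀ n → + ones n ≡ z (suc n)
ones≡z zero    = refl
ones≡z (suc n) = trans (cong₂ ℤ._+_ (ones≡z n) (toℕ-ℓ n))
  (trans (cong₂ (λ i j → z (suc n) ℤ.+ (z i ℤ.- z j)) (ℕ.+-comm n 2) (ℕ.+-comm n 1))
         (cancel (z (suc n)) (z (2 + n))))
  where
  cancel : ∀ a b → a ℤ.+ (b ℤ.- a) ≡ b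
  cancel = ℤ-Solver.solve-∀

-- Balance of the Fibonacci word: `z-+` at i + 1 and n + 1, read through `ones≡z`. The index shift
-- is why length n + 1 is paired with `ones n`.
ones-+ : ∀ i n → ones (i + suc n) ≡ ones i + ones n ⊎ ones (i + suc n) ≡ ones i + suc (ones n)
ones-+ i n = Sum.map (conclude 0) (conclude 1) (z-+ (suc i) (suc n) (s≤s z≤n) (s≤s z≤n))
  where
  expand : ∀ a b c → c ≡ (c ℤ.- a ℤ.- b) ℤ.+ (a ℤ.+ b)
  expand = ℤ-Solver.solve-∀
  swap : ∀ k a b → k + (a + b) ≡ a + (k + b)
  swap = solve-∀
  conclude : ∀ k → z (suc (i + suc n)) ℤ.- z (suc i) ℤ.- z (suc n) ≡ + k →
             ones (i + suc n) ≡ ones i + (k + ones n)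
  conclude k eq = ℤ.+-injective (begin
    + ones (i + suc n)                       ≡⟨ ones≡z (i + suc n) ⟩
    z (suc (i + suc n))                      ≡⟨ expand (z (suc i)) (z (suc n)) _ ⟩
    z (suc (i + suc n)) ℤ.- z (suc i) ℤ.- z (suc n) ℤ.+ (z (suc i) ℤ.+ z (suc n))
      ≡⟨ cong₂ ℤ._+_ eq (cong₂ ℤ._+_ (sym (ones≡z i)) (sym (ones≡z n))) ⟩
    + (k + (ones i + ones n))                ≡⟨ cong +_ (swap k (ones i) (ones n)) ⟩
    + (ones i + (k + ones n))                ∎)
    where open ≡-Reasoning

-- Because `ones 1` = 0, balance allows at most one letter 1 in a factor of length two.
no-11 : ∀ n → ℓ n ≡ suc zero → ℓ (suc n) ≡ zero
no-11 n eq with ℓ (suc n) in eq′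
... | zero     = refl
... | suc zero = ⊥-elim ([ clash z≤n , clash (s≤s z≤n) ]′ (ones-+ n 1))
  where
  two : ones n + 2 ≡ ones (n + 2)
  two = trans (sym (ℕ.+-assoc (ones n) 1 1))
    (trans (cong₂ (λ a b → ones n + toℕ a + toℕ b) (sym eq) (sym eq′)) (cong ones (ℕ.+-comm 2 n)))
  clash : ∀ {k} → k ℕ.≤ 1 → ones (n + 2) ≢ ones n + k
  clash k≤1 h = ℕ.<⇒≢ (s≤s k≤1) (sym (ℕ.+-cancelˡ-≡ (ones n) _ _ (trans two h)))

-- Factors

factor : ℕ → ℕ → Word
factor i zero    = []
factor i (suc n) = ℓ i ∷ factor (suc i) n

length-factor : ∀ i n → length (factor i n) ≡ n
length-factor i zero    = refl
length-factor i (suc n) = cong suc (length-factor (suc i) n)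

applyUpTo-cong : ∀ {A : Set} {f g : ℕ → A} → (∀ j → f j ≡ g j) → ∀ n → applyUpTo f n ≡ applyUpTo g n
applyUpTo-cong h zero    = refl
applyUpTo-cong h (suc n) = cong₂ _∷_ (h 0) (applyUpTo-cong (h ∘ suc) n)

factor-occursAt : ∀ i n → OccursAt i (factor i n)
factor-occursAt i zero    = refl
factor-occursAt i (suc n) = cong₂ _∷_
  (trans (toℕ-ℓ i) (cong cα (sym (ℕ.+-identityʳ i))))
  (trans (factor-occursAt (suc i) n)
    (applyUpTo-cong (λ j → cong cα (sym (ℕ.+-suc i j))) (length (factor (suc i) n))))

-- With `factor-occursAt`, this lets positions and lengths stand in for the words of the language.
occursAt⇒factor : ∀ i w → OccursAt i w → w ≡ factor i (length w)
occursAt⇒factor i []      occ = refl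
occursAt⇒factor i (a ∷ w) occ with eqa , eqw ← ∷-injective occ =
  cong₂ _∷_
    (toℕ-injective (ℤ.+-injective (trans eqa (trans (cong cα (ℕ.+-identityʳ i)) (sym (toℕ-ℓ i))))))
    (occursAt⇒factor (suc i) w
      (trans eqw (applyUpTo-cong (λ j → cong cα (ℕ.+-suc i j)) (length w))))

weight : (Letter → ℕ) → Word → ℕ
weight wt w = sum (map wt w)

prefixWeight-+ : ∀ wt i n → prefixWeight wt (i + n) ≡ prefixWeight wt i + weight wt (factor i n)
prefixWeight-+ wt i zero    = trans (cong (prefixWeight wt) (ℕ.+-identityʳ i)) (sym (ℕ.+-identityʳ _))
prefixWeight-+ wt i (suc n) = trans (cong (prefixWeight wt) (ℕ.+-suc i n))
  (trans (prefixWeight-+ wt (suc i) n) (ℕ.+-assoc (prefixWeight wt i) (wt (ℓ i)) _))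

weights : ℕ → ℕ → Letter → ℕ
weights a b zero       = a
weights a b (suc zero) = b

weight-weights : ∀ a b w → weight (weights a b) w ≡ a * (length w ∸ weight toℕ w) + b * weight toℕ w
weight-weights a b w = trans (sum≡ w) (cong (λ x → a * x + b * weight toℕ w)
  (sym (trans (cong (_∸ weight toℕ w) (length≡ w)) (ℕ.m+n∸m≡n (weight toℕ w) (zeros w)))))
  where
  -- Counting the zeros directly keeps truncated subtraction out of the induction; `length≡`
  -- restores it at the end.
  zeros : Word → ℕ
  zeros = weight (weights 1 0)
  length≡ : ∀ w → length w ≡ weight toℕ w + zeros w
  length≡ []             = refl
  length≡ (zero ∷ w)     = trans (cong suc (length≡ w)) (sym (ℕ.+-suc (weight toℕ w) (zeros w)))
  length≡ (suc zero ∷ w) = cong suc (length≡ w)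
  zero-step : ∀ a b k l → a + (a * k + b * l) ≡ a * suc k + b * l
  zero-step = solve-∀
  one-step : ∀ a b k l → b + (a * k + b * l) ≡ a * k + b * suc l
  one-step = solve-∀
  sum≡ : ∀ w → weight (weights a b) w ≡ a * zeros w + b * weight toℕ w
  sum≡ []             = sym (cong₂ _+_ (ℕ.*-zeroʳ a) (ℕ.*-zeroʳ b))
  sum≡ (zero ∷ w)     = trans (cong (_+_ a) (sum≡ w)) (zero-step a b (zeros w) (weight toℕ w))
  sum≡ (suc zero ∷ w) = trans (cong (_+_ b) (sum≡ w)) (one-step a b (zeros w) (weight toℕ w))

weightWith : ℕ → ℕ → ℕ → ℕ → ℕ
weightWith a b n k = a * (n ∸ k) + b * k

-- By balance the number of letters 1 takes at most two values at each length, and it determines the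
-- weight.
factor-weight : ∀ a b i n → let v = weight (weights a b) (factor i (suc n)) in
                v ≡ weightWith a b (suc n) (ones n) ⊎ v ≡ weightWith a b (suc n) (suc (ones n))
factor-weight a b i n = Sum.map conclude conclude (ones-+ i n)
  where
  conclude : ∀ {k} → ones (i + suc n) ≡ ones i + k →
             weight (weights a b) (factor i (suc n)) ≡ weightWith a b (suc n) k
  conclude {k} eq = trans (weight-weights a b (factor i (suc n)))
    (cong₂ (weightWith a b) (length-factor i (suc n))
      (ℕ.+-cancelˡ-≡ (ones i) _ _ (trans (sym (prefixWeight-+ toℕ i (suc n))) eq)))

-- Attained weights

-- The image of a homomorphism in terms of its two letter values only, so that concrete pairs can be
-- treated by computation.
Attained : ℕ → ℕ → Pred ℕ 0ℓ
Attained a b N = ∃ λ w → FibonacciLanguage w × weight (weights a b) w ≡ N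

attained⇒factor : ∀ {a b N} → Attained a b N → ∃ λ i → ∃ λ n → weight (weights a b) (factor i (suc n)) ≡ N
attained⇒factor ([] , (w≢[] , _) , _) = contradiction refl w≢[]
attained⇒factor {a} {b} (c ∷ w , (_ , i , occ) , eq) =
  i , length w , trans (cong (weight (weights a b)) (sym (occursAt⇒factor i (c ∷ w) occ))) eq

module Covering (a b : ℕ) (1≤a : 1 ℕ.≤ a) (1≤b : 1 ℕ.≤ b) where

  W : ℕ → ℕ
  W = prefixWeight (weights a b)

  1≤weights : ∀ c → 1 ℕ.≤ weights a b c
  1≤weights zero       = 1≤a
  1≤weights (suc zero) = 1≤b

  -- The factor between positions i and j has weight N. The order j ≤ i is impossible because prefix
  -- weights never decrease and N is positive.
  difference-attained : ∀ i j {N} → 1 ℕ.≤ N → W i + N ≡ W j → Attained a b N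
  difference-attained i j {N} 1≤N eq with ℕ.<-≤-connex i j
  ... | inj₁ i<j with n , refl ← ℕ.m≤n⇒∃[o]m+o≡n i<j =
        factor i (suc n) , ((λ ()) , i , factor-occursAt i (suc n)) ,
        ℕ.+-cancelˡ-≡ (W i) _ _ (trans (sym (prefixWeight-+ (weights a b) i (suc n)))
          (trans (cong W (ℕ.+-suc i n)) (sym eq)))
  ... | inj₂ j≤i with n , refl ← ℕ.m≤n⇒∃[o]m+o≡n j≤i =
        ⊥-elim (ℕ.<⇒≱ (ℕ.<-≤-trans (ℕ.m<m+n (W i) 1≤N) (ℕ.≤-reflexive eq))
          (subst (W j ℕ.≤_) (sym (prefixWeight-+ (weights a b) j n)) (ℕ.m≤m+n (W j) _)))

  -- Counting up from 0, the offset e grows until it reaches the weight of the current letter; then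
  -- the next prefix starts with offset 0.
  bracket : ∀ N → ∃ λ n → ∃ λ e → e ℕ.< weights a b (ℓ n) × N ≡ W n + e
  bracket zero = 0 , 0 , 1≤weights (ℓ 0) , refl
  bracket (suc N) with n , e , e< , eq ← bracket N with ℕ.m≤n⇒m<n∨m≡n e<
  ... | inj₁ lt  = n , suc e , lt , trans (cong suc eq) (sym (ℕ.+-suc (W n) e))
  ... | inj₂ eq′ = suc n , 0 , 1≤weights (ℓ (suc n)) ,
        trans (cong suc eq) (trans (sym (ℕ.+-suc (W n) e))
          (trans (cong (_+_ (W n)) eq′) (sym (ℕ.+-identityʳ (W (suc n))))))

  step : ∀ n {c} → ℓ n ≡ c → W (suc n) ≡ W n + weights a b c
  step n eq = cong (λ c → W n + weights a b c) eq

  -- Each number from `W n` up to, but excluding, `W (suc n)` is to arise from a prefix of length j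
  -- by removing its first i letters.
  Filled : Set
  Filled = ∀ n e → e ℕ.< weights a b (ℓ n) → ∃ λ i → ∃ λ j → W i + (W n + e) ≡ W j

  filled⇒attained : Filled → ∀ {N} → 1 ℕ.≤ N → Attained a b N
  filled⇒attained fill {N} 1≤N
    with n , e , e< , refl ← bracket N
    with i , j , eq ← fill n e e< = difference-attained i j 1≤N eq

-- The four exceptional pairs

filled-1-1 : Covering.Filled 1 1 (s≤s z≤n) (s≤s z≤n)
filled-1-1 n zero    e< = 0 , n , ℕ.+-identityʳ _
filled-1-1 n (suc e) e< with ℓ n
filled-1-1 n (suc e) (s≤s ()) | zero
filled-1-1 n (suc e) (s≤s ()) | suc zero

filled-1-2 : Covering.Filled 1 2 (s≤s z≤n) (s≤s z≤n)
filled-1-2 n zero    e< = 0 , n , ℕ.+-identityʳ _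
filled-1-2 n (suc e) e< with ℓ n in eq
filled-1-2 n (suc e) (s≤s ())         | zero
-- The first letter is 0, so `W 1` = 1, and its removal lowers `W n` + 2 by one.
filled-1-2 n 1       e<               | suc zero = 1 , suc n ,
  trans (shift (W n)) (sym (step n eq))
  where
  open Covering 1 2 (s≤s z≤n) (s≤s z≤n)
  shift : ∀ x → 1 + (x + 1) ≡ x + 2
  shift = solve-∀
filled-1-2 n (suc (suc e)) (s≤s (s≤s ())) | suc zero

filled-2-1 : Covering.Filled 2 1 (s≤s z≤n) (s≤s z≤n)
filled-2-1 n zero    e< = 0 , n , ℕ.+-identityʳ _
filled-2-1 n (suc e) e< with ℓ n in eq
filled-2-1 n (suc e)       (s≤s ())       | suc zero
filled-2-1 n (suc (suc e)) (s≤s (s≤s ())) | zero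
filled-2-1 n 1 e< | zero with ℓ (suc n) in eq′
-- `W (2 + n)` is `W n` + 4 or `W n` + 3; subtracting `W 2` = 3 or `W 1` = 2 respectively leaves
-- `W n` + 1.
... | zero     = 2 , 2 + n , trans (shift (W n)) (sym (trans (step (suc n) eq′) (cong (_+ 2) (step n eq))))
  where
  open Covering 2 1 (s≤s z≤n) (s≤s z≤n)
  shift : ∀ x → 3 + (x + 1) ≡ x + 2 + 2
  shift = solve-∀
... | suc zero = 1 , 2 + n , trans (shift (W n)) (sym (trans (step (suc n) eq′) (cong (_+ 1) (step n eq))))
  where
  open Covering 2 1 (s≤s z≤n) (s≤s z≤n)
  shift : ∀ x → 2 + (x + 1) ≡ x + 2 + 1
  shift = solve-∀

filled-1-3 : Covering.Filled 1 3 (s≤s z≤n) (s≤s z≤n)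
filled-1-3 n zero    e< = 0 , n , ℕ.+-identityʳ _
filled-1-3 n (suc e) e< with ℓ n in eq
filled-1-3 n (suc e)             (s≤s ())             | zero
filled-1-3 n (suc (suc (suc e))) (s≤s (s≤s (s≤s ()))) | suc zero
filled-1-3 n 2 e< | suc zero = 1 , suc n , trans (shift (W n)) (sym (step n eq))
  where
  open Covering 1 3 (s≤s z≤n) (s≤s z≤n)
  shift : ∀ x → 1 + (x + 2) ≡ x + 3
  shift = solve-∀
filled-1-3 n 1 e< | suc zero with ℓ (2 + n) in eq″
-- The letter after a 1 is 0, so `W (3 + n)` is `W n` + 5 or `W n` + 7; subtracting `W 2` = 4 or
-- `W 4` = 6 respectively leaves `W n` + 1.
... | zero     = 2 , 3 + n , trans (shift (W n))
      (sym (trans (step (2 + n) eq″) (cong (_+ 1) (trans (step (suc n) (no-11 n eq)) (cong (_+ 1) (step n eq))))))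
  where
  open Covering 1 3 (s≤s z≤n) (s≤s z≤n)
  shift : ∀ x → 4 + (x + 1) ≡ x + 3 + 1 + 1
  shift = solve-∀
... | suc zero = 4 , 3 + n , trans (shift (W n))
      (sym (trans (step (2 + n) eq″) (cong (_+ 3) (trans (step (suc n) (no-11 n eq)) (cong (_+ 1) (step n eq))))))
  where
  open Covering 1 3 (s≤s z≤n) (s≤s z≤n)
  shift : ∀ x → 6 + (x + 1) ≡ x + 3 + 1 + 3
  shift = solve-∀

𝓔-attained : ∀ {a b} → (a , b) ∈ 𝓔 → ∀ {N} → 1 ℕ.≤ N → Attained a b N
𝓔-attained (here refl) =
  Covering.filled⇒attained 1 1 (s≤s z≤n) (s≤s z≤n) filled-1-1
𝓔-attained (there (here refl)) =
  Covering.filled⇒attained 1 2 (s≤s z≤n) (s≤s z≤n) filled-1-2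
𝓔-attained (there (there (here refl))) =
  Covering.filled⇒attained 1 3 (s≤s z≤n) (s≤s z≤n) filled-1-3
𝓔-attained (there (there (there (here refl)))) =
  Covering.filled⇒attained 2 1 (s≤s z≤n) (s≤s z≤n) filled-2-1

-- Gaps

-- If all these consecutive numbers were in the list, two of them would share an index and hence be
-- equal.
fresh : ∀ (xs : List ℕ) N → ∃ λ m → N ℕ.≤ m × m ℕ.≤ N + length xs × m ∉ xs
fresh xs N with any? {n = suc (length xs)} (λ i → ¬? (_∈?_ ℕ._≟_ (N + toℕ i) xs))
... | yes (i , ∉xs) = N + toℕ i , ℕ.m≤m+n N _ , ℕ.+-monoʳ-≤ N (s≤s⁻¹ (toℕ<n i)) , ∉xs
... | no none = ⊥-elim (ℕ.<⇒≢ i<j (ℕ.+-cancelˡ-≡ N _ _ (trans (lookup-index (member i))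
        (trans (cong (lookup xs) same) (sym (lookup-index (member j)))))))
  where
  member : ∀ i → N + toℕ i ∈ xs
  member i = decidable-stable (_∈?_ ℕ._≟_ _ xs) (λ ∉xs → none (i , ∉xs))
  collision = pigeonhole (ℕ.n<1+n (length xs)) (index ∘ member)
  i = proj₁ collision
  j = proj₁ (proj₂ collision)
  i<j = proj₁ (proj₂ (proj₂ collision))
  same = proj₂ (proj₂ (proj₂ collision))

-- Searching strictly above the previous value makes the sequence strictly increasing, hence
-- injective.
unbounded⇒infinite : {P : Pred ℕ 0ℓ} → (∀ N → ∃ λ m → N ℕ.≤ m × P m) → Infinite P
unbounded⇒infinite {P} next = f , injective , holds
  where
  f : ℕ → ℕ
  f zero    = proj₁ (next 0)
  f (suc k) = proj₁ (next (suc (f k)))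
  holds : ∀ k → P (f k)
  holds zero    = proj₂ (proj₂ (next 0))
  holds (suc k) = proj₂ (proj₂ (next (suc (f k))))
  f-mono : ∀ {i j} → i ℕ.<′ j → f i ℕ.< f j
  f-mono {i} ℕ.<′-base       = proj₁ (proj₂ (next (suc (f i))))
  f-mono (ℕ.<′-step {j} i<j) = ℕ.<-trans (f-mono i<j) (proj₁ (proj₂ (next (suc (f j)))))
  injective : Injective _≡_ _≡_ f
  injective {i} {j} eq with ℕ.<-cmp i j
  ... | tri< i<j _ _ = contradiction eq (ℕ.<⇒≢ (f-mono (ℕ.<⇒<′ i<j)))
  ... | tri≈ _ i≡j _ = i≡j
  ... | tri> _ _ j<i = contradiction (sym eq) (ℕ.<⇒≢ (f-mono (ℕ.<⇒<′ j<i)))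

-- Heavy blocks and density

-- Two possible weights per length give 42 for every 21 lengths, so a block weight of 45 leaves at
-- least 3 values to spare.
Heavy : ℕ → ℕ → Set
Heavy a b = 45 ℕ.≤ weightWith a b 21 8 × 45 ℕ.≤ weightWith a b 21 9

heavy-mono : ∀ {a b a′ b′} → a ℕ.≤ a′ → b ℕ.≤ b′ → Heavy a b → Heavy a′ b′
heavy-mono a≤ b≤ (h₈ , h₉) =
  ℕ.≤-trans h₈ (ℕ.+-mono-≤ (ℕ.*-monoˡ-≤ 13 a≤) (ℕ.*-monoˡ-≤ 8 b≤)) ,
  ℕ.≤-trans h₉ (ℕ.+-mono-≤ (ℕ.*-monoˡ-≤ 12 a≤) (ℕ.*-monoˡ-≤ 9 b≤))

-- Outside `𝓔` and apart from (2,2), every pair dominates (1,4), (2,3) or (3,1). Their block weights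
-- are 45 and 48, 50 and 51, 47 and 45.
heavy-or-even : ∀ a b → 1 ℕ.≤ a → 1 ℕ.≤ b → (a , b) ∉ 𝓔 → (a ≡ 2 × b ≡ 2) ⊎ Heavy a b
heavy-or-even 1 1 _ _ ∉𝓔 = contradiction (here refl) ∉𝓔
heavy-or-even 1 2 _ _ ∉𝓔 = contradiction (there (here refl)) ∉𝓔
heavy-or-even 1 3 _ _ ∉𝓔 = contradiction (there (there (here refl))) ∉𝓔
heavy-or-even 1 (suc (suc (suc (suc b)))) _ _ _ =
  inj₂ (heavy-mono {1} {4} ℕ.≤-refl (ℕ.m≤m+n 4 b) (ℕ.m≤m+n 45 0 , ℕ.m≤m+n 45 3))
heavy-or-even 2 1 _ _ ∉𝓔 = contradiction (there (there (there (here refl)))) ∉𝓔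
heavy-or-even 2 2 _ _ _ = inj₁ (refl , refl)
heavy-or-even 2 (suc (suc (suc b))) _ _ _ =
  inj₂ (heavy-mono {2} {3} ℕ.≤-refl (ℕ.m≤m+n 3 b) (ℕ.m≤m+n 45 5 , ℕ.m≤m+n 45 6))
heavy-or-even (suc (suc (suc a))) b _ 1≤b _ =
  inj₂ (heavy-mono {3} {1} (ℕ.m≤m+n 3 a) 1≤b (ℕ.m≤m+n 45 2 , ℕ.m≤m+n 45 0))

ones-20 : ones 20 ≡ 8
ones-20 = refl

module _ {a b : ℕ} (heavy : Heavy a b) where

  private
    wt = weights a b
    W  = prefixWeight wt

  block-weight : ∀ i → 45 ℕ.≤ weight wt (factor i 21)
  block-weight i = [ at-least ones-20 (proj₁ heavy) , at-least (cong suc ones-20) (proj₂ heavy) ]′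
                     (factor-weight a b i 20)
    where
    at-least : ∀ {v k k′} → k ≡ k′ → 45 ℕ.≤ weightWith a b 21 k′ → v ≡ weightWith a b 21 k → 45 ℕ.≤ v
    at-least refl h refl = h

  block : ∀ i → W i + 45 ℕ.≤ W (i + 21)
  block i = ℕ.≤-trans (ℕ.+-monoʳ-≤ (W i) (block-weight i)) (ℕ.≤-reflexive (sym (prefixWeight-+ wt i 21)))

  blocks : ∀ i q → W i + q * 45 ℕ.≤ W (i + q * 21)
  blocks i zero    = ℕ.≤-reflexive (trans (ℕ.+-identityʳ (W i)) (cong W (sym (ℕ.+-identityʳ i))))
  blocks i (suc q) = begin
    W i + (45 + q * 45)    ≡⟨ ℕ.+-assoc (W i) 45 (q * 45) ⟨
    W i + 45 + q * 45      ≤⟨ ℕ.+-monoˡ-≤ (q * 45) (block i) ⟩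
    W (i + 21) + q * 45    ≤⟨ blocks (i + 21) q ⟩
    W (i + 21 + q * 21)    ≡⟨ cong W (ℕ.+-assoc i 21 (q * 21)) ⟩
    W (i + (21 + q * 21))  ∎
    where open ℕ.≤-Reasoning

  -- A factor of length at least 21q begins with q consecutive blocks and so weighs at least 45q.
  light⇒short : ∀ i n q → weight wt (factor i n) ℕ.< q * 45 → n ℕ.< q * 21
  light⇒short i n q light = ℕ.≰⇒> λ q*21≤n → not-long (ℕ.m≤n⇒∃[o]m+o≡n q*21≤n)
    where
    open ℕ.≤-Reasoning
    not-long : ¬ ∃ λ o → q * 21 + o ≡ n
    not-long (o , refl) = ℕ.<⇒≱ light (ℕ.+-cancelˡ-≤ (W i) _ _ (begin
      W i + q * 45                                   ≤⟨ blocks i q ⟩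
      W (i + q * 21)                                 ≤⟨ ℕ.m≤m+n _ _ ⟩
      W (i + q * 21) + weight wt (factor (i + q * 21) o)  ≡⟨ prefixWeight-+ wt (i + q * 21) o ⟨
      W (i + q * 21 + o)                             ≡⟨ cong W (ℕ.+-assoc i (q * 21) o) ⟩
      W (i + (q * 21 + o))                           ≡⟨ prefixWeight-+ wt i (q * 21 + o) ⟩
      W i + weight wt (factor i (q * 21 + o))        ∎))

  -- Both possible weights for each of the lengths 1 to L. Repetitions are harmless, since only the
  -- number of entries matters.
  candidates : ℕ → List ℕ
  candidates L = applyUpTo (λ n → weightWith a b (suc n) (ones n)) L ++
                 applyUpTo (λ n → weightWith a b (suc n) (suc (ones n))) L

  length-candidates : ∀ L → length (candidates L) ≡ L + L
  length-candidates L = trans (length-++ (applyUpTo _ L)) (cong₂ _+_ (length-applyUpTo _ L) (length-applyUpTo _ L))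

  attained⇒candidate : ∀ q {m} → m ℕ.< q * 45 → Attained a b m → m ∈ candidates (q * 21)
  attained⇒candidate q m< att with i , n , refl ← attained⇒factor att =
    [ (λ eq → subst (_∈ candidates (q * 21)) (sym eq) (∈-++⁺ˡ (∈-applyUpTo⁺ _ n<)))
    , (λ eq → subst (_∈ candidates (q * 21)) (sym eq) (∈-++⁺ʳ (applyUpTo _ (q * 21)) (∈-applyUpTo⁺ _ n<)))
    ]′ (factor-weight a b i n)
    where
    n< : n ℕ.< q * 21
    n< = ℕ.<-trans (ℕ.n<1+n n) (light⇒short i (suc n) q m<)

  -- The numbers from N to N + 42q all lie below 45q, and the 42q candidates cannot cover them.
  gap-from : ∀ q N → N + (q * 21 + q * 21) ℕ.< q * 45 → ∃ λ m → N ℕ.≤ m × ¬ Attained a b m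
  gap-from q N room with m , N≤m , m≤ , m∉ ← fresh (candidates (q * 21)) N =
    m , N≤m , m∉ ∘ attained⇒candidate q
      (ℕ.≤-<-trans (subst (λ l → m ℕ.≤ N + l) (length-candidates (q * 21)) m≤) room)

  heavy-gap : ∀ N → ∃ λ m → N ℕ.≤ m × ¬ Attained a b m
  heavy-gap N = gap-from (suc N) N
    -- With q = N + 1 the surplus 3q exceeds N.
    (subst (N + (suc N * 21 + suc N * 21) ℕ.<_) (spare N) (ℕ.m<m+n _ (s≤s z≤n)))
    where
    spare : ∀ N → N + (suc N * 21 + suc N * 21) + (3 + (N + N)) ≡ suc N * 45
    spare = solve-∀

even-gap : ∀ N → ∃ λ m → N ℕ.≤ m × ¬ Attained 2 2 m
-- An odd witness suffices, as every weight is even.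
even-gap N = suc (2 * N) , ℕ.m≤n⇒m≤1+n (ℕ.m≤m+n N _) ,
  λ where (w , _ , eq) → ℕ.even≢odd ((length w ∸ weight toℕ w) + weight toℕ w) N (trans (sym (weight-2-2 w)) eq)
  where
  weight-2-2 : ∀ w → weight (weights 2 2) w ≡ 2 * ((length w ∸ weight toℕ w) + weight toℕ w)
  weight-2-2 w = trans (weight-weights 2 2 w)
    (sym (ℕ.*-distribˡ-+ 2 (length w ∸ weight toℕ w) (weight toℕ w)))

∉𝓔-gap : ∀ {a b} → 1 ℕ.≤ a → 1 ℕ.≤ b → (a , b) ∉ 𝓔 → ∀ N → ∃ λ m → N ℕ.≤ m × ¬ Attained a b m
∉𝓔-gap {a} {b} 1≤a 1≤b ∉𝓔 with heavy-or-even a b 1≤a 1≤b ∉𝓔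
... | inj₁ (refl , refl) = even-gap
... | inj₂ heavy         = heavy-gap heavy

-- Transfer to homomorphisms

module _ (h : Homomorphism) where

  open Homomorphism h

  private
    a = S (letter zero)
    b = S (letter (suc zero))

  S≡weight : ∀ u → S u ≡ weight (weights a b) (proj₁ u)
  S≡weight u = trans (isHom u) (cong sum (map-cong (λ { zero → refl ; (suc zero) → refl }) (proj₁ u)))

  attained⇒image : ∀ {N} → Attained a b N → Image S N
  attained⇒image (w , w∈𝓛 , eq) = (w , w∈𝓛) , trans (S≡weight (w , w∈𝓛)) eq

  image⇒attained : ∀ {N} → Image S N → Attained a b N
  image⇒attained (u@(w , w∈𝓛) , eq) = w , w∈𝓛 , trans (sym (S≡weight u)) eq

theorem6 : (h : Homomorphism) → let open Homomorphism h in
    ((S (letter zero) , S (letter (suc zero))) ∈ 𝓔 → Empty (ℕ⁺ ∖ Image S)) ×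
    ((S (letter zero) , S (letter (suc zero))) ∉ 𝓔 → Infinite (ℕ⁺ ∖ Image S))
theorem6 h =
  (λ ∈𝓔 N (1≤N , N∉) → N∉ (attained⇒image h (𝓔-attained ∈𝓔 1≤N))) ,
  (λ ∉𝓔 → unbounded⇒infinite {ℕ⁺ ∖ Image S} λ N →
    -- Searching from N + 1 also makes m positive, as membership in `ℕ⁺` demands.
    let m , N<m , m∉ = ∉𝓔-gap (positive (letter zero)) (positive (letter (suc zero))) ∉𝓔 (suc N)
    in m , ℕ.<⇒≤ N<m , ℕ.≤-trans (s≤s z≤n) N<m , m∉ ∘ image⇒attained h)
  where open Homomorphism h
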